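{- For every integer $k\ge 29$, $\Gamma_{\rho}(P_k)=7$, where $P_k$ is the path on $k$ vertices.
   Context: $d(u,v)$ is graph distance. A packing coloring $c:V(G)\to\{1,\dots,k\}$ satisfies: $c(u)=c(v)=i$, $u\ne v$, implies $d(u,v)>i$. The Grundy packing chromatic number $\Gamma_{\rho}(G)$ is the maximum number of colors $k$ in a packing coloring $c:V(G)\to\{1,\dots,k\}$ using all $k$ colors in which every vertex $v$ with $c(v)=i$ has, for every $j\in\{1,\dots,i-1\}$, a vertex $u$ with $c(u)=j$ and $d(u,v)\le j$ (equivalently, the maximum number of colors produced by the greedy procedure that processes vertices in some order and assigns each vertex the smallest color $i$ with no already-colored vertex of color $i$ at distance at most $i$). -}

module Defs where

open import Data.Nat using (ℕ; suc; _≤_; _<_; ∣_-_∣)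
open import Data.Fin using (Fin; toℕ)
open import Data.Product using (_×_; ∃-syntax)
open import Relation.Binary.PropositionalEquality using (_≡_; _≢_)

-- The path P_k has vertex set Fin k, with i adjacent to i+1.
-- Its graph distance is d(u,v) = |u - v|.
pathDist : {k : ℕ} → Fin k → Fin k → ℕ
pathDist u v = ∣ toℕ u - toℕ v ∣

UsesColours : {k : ℕ} → ℕ → (Fin k → ℕ) → Set
UsesColours {k} m c =
  ((v : Fin k) → (1 ≤ c v) × (c v ≤ m)) ×
  ((i : ℕ) → 1 ≤ i → i ≤ m → ∃[ v ] c v ≡ i)

IsPacking : {k : ℕ} → (Fin k → ℕ) → Set
IsPacking {k} c = (u v : Fin k) → u ≢ v → c u ≡ c v → c u < pathDist u v

IsGrundy : {k : ℕ} → (Fin k → ℕ) → Set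
IsGrundy {k} c = (v : Fin k) (j : ℕ) → 1 ≤ j → j < c v →
  ∃[ u ] (c u ≡ j) × (pathDist u v ≤ j)

GrundyPacking : (k m : ℕ) → (Fin k → ℕ) → Set
GrundyPacking k m c = UsesColours m c × IsPacking c × IsGrundy c

GrundyPackingNumberIs : ℕ → ℕ → Set
GrundyPackingNumberIs k m =
  (∃[ c ] GrundyPacking k m c) ×
  ((m' : ℕ) (c : Fin k → ℕ) → GrundyPacking k m' c → m' ≤ m)

{-# OPTIONS --safe #-}
-- Lower bound: a word of length 23 containing the colours 1, …, 7, continued
-- by the period 1 3 1 2, stays a Grundy packing colouring when truncated to any
-- length k ≥ 29.
-- Upper bound: a vertex of colour 8 constrains the colours around it so
-- strongly that a window of 19 vertices centred at it cannot be coloured.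
-- Extending the colouring by 0 off the path to all of ℤ and capping it at 8
-- removes the boundary cases, and the finite search grows a word around the
-- colour 8, adding one letter at alternating ends.
module Submission where

open import Defs
open import Data.Bool using (Bool; false; T; _∧_; _∨_; not)
open import Data.Bool.ListAction using (any; all)
open import Data.Bool.Properties using (T-∧; T-∨; T-not-≡)
open import Data.Fin using (Fin; toℕ; fromℕ<)
open import Data.Fin.Properties using (toℕ-fromℕ<; toℕ-injective; toℕ<n; fromℕ<-toℕ)
open import Data.Integer as ℤ using (ℤ; +_; -[1+_])
import Data.Integer.Properties as ℤ
open import Data.Integer.Tactic.RingSolver using (solve-∀)
open import Data.List using (List; []; _∷_; length; reverse; upTo; applyUpTo; applyDownFrom)
open import Data.List.Membership.Propositional using (find)
open import Data.List.Membership.Propositional.Properties using (∈-upTo⁺; ∈-applyUpTo⁻)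
open import Data.List.Properties using (length-applyUpTo; reverse-applyUpTo)
import Data.List.Relation.Unary.All as All
open import Data.List.Relation.Unary.All.Properties using (all⁺)
open import Data.List.Relation.Unary.Any.Properties using (any⁻)
open import Data.Nat
open import Data.Nat.Properties
open import Data.Product using (_×_; _,_; ∃-syntax; proj₁; proj₂)
open import Data.Sum using (_⊎_; inj₁; inj₂; [_,_]′)
open import Data.Unit using (tt)
open import Function using (_∘_; Equivalence)
open import Relation.Binary.Definitions using (tri<; tri≈; tri>)
open import Relation.Binary.PropositionalEquality
open import Relation.Nullary using (¬_; contradiction)
open import Relation.Nullary.Decidable using (from-yes; _→-dec_; _×-dec_; yes; no)
open Equivalence using (to; from)

-- The periodic tail 1 3 1 2

period : ℕ → ℕ
period 0 = 1
period 1 = 3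
period 2 = 1
period 3 = 2
period (suc (suc (suc (suc n)))) = period n

-- Four consecutive values determine the phase, so the step from n to 4 + n is
-- definitional.
period-elim : {Q : ℕ → ℕ → ℕ → ℕ → Set} →
  (∀ {n} → n < 4 → Q (period n) (period (1 + n)) (period (2 + n)) (period (3 + n))) →
  ∀ n → Q (period n) (period (1 + n)) (period (2 + n)) (period (3 + n))
period-elim base 0 = base (s≤s z≤n)
period-elim base 1 = base (s≤s (s≤s z≤n))
period-elim base 2 = base (s≤s (s≤s (s≤s z≤n)))
period-elim base 3 = base (s≤s (s≤s (s≤s (s≤s z≤n))))
period-elim {Q} base (suc (suc (suc (suc n)))) = period-elim {Q} base n

period-bounds : ∀ n → 1 ≤ period n × period n ≤ 3
period-bounds = period-elim {λ a _ _ _ → 1 ≤ a × a ≤ 3}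
  (from-yes (allUpTo? (λ n → 1 ≤? period n ×-dec period n ≤? 3) 4))

period-packing : ∀ n d → period n ≡ period (suc d + n) → period n < suc d
period-packing n 0 = period-elim {λ a b _ _ → a ≡ b → a < 1}
  (from-yes (allUpTo? (λ n → period n ≟ period (1 + n) →-dec period n <? 1) 4)) n
period-packing n 1 = period-elim {λ a _ b _ → a ≡ b → a < 2}
  (from-yes (allUpTo? (λ n → period n ≟ period (2 + n) →-dec period n <? 2) 4)) n
period-packing n 2 = period-elim {λ a _ _ b → a ≡ b → a < 3}
  (from-yes (allUpTo? (λ n → period n ≟ period (3 + n) →-dec period n <? 3) 4)) n
period-packing n (suc (suc (suc d))) _ =
  s≤s (≤-trans (proj₂ (period-bounds n)) (m≤m+n 3 d))

period-preceded-by-1 : ∀ n → 1 < period (1 + n) → period n ≡ 1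
period-preceded-by-1 = period-elim {λ a b _ _ → 1 < b → a ≡ 1}
  (from-yes (allUpTo? (λ n → 1 <? period (1 + n) →-dec period n ≟ 1) 4))

period-preceded-by-2 : ∀ n → 2 < period (2 + n) → period n ≡ 2
period-preceded-by-2 = period-elim {λ a _ b _ → 2 < b → a ≡ 2}
  (from-yes (allUpTo? (λ n → 2 <? period (2 + n) →-dec period n ≟ 2) 4))

-- The explicit colouring with seven colours

prepend : List ℕ → (ℕ → ℕ) → ℕ → ℕ
prepend []      f n       = f n
prepend (x ∷ w) f zero    = x
prepend (x ∷ w) f (suc n) = prepend w f n

colour : ℕ → ℕ
colour = prepend
  (1 ∷ 4 ∷ 2 ∷ 1 ∷ 3 ∷ 5 ∷ 1 ∷ 2 ∷ 1 ∷ 7 ∷ 3 ∷ 1 ∷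
   2 ∷ 4 ∷ 1 ∷ 6 ∷ 2 ∷ 1 ∷ 3 ∷ 5 ∷ 1 ∷ 2 ∷ 4 ∷ []) period

-- The offset form matters: matching on `refl` makes `colour (23 + i)` reduce to `period i`.
below-or-offset : ∀ m n → n < m ⊎ ∃[ i ] n ≡ m + i
below-or-offset m n with n <? m
... | yes n<m = inj₁ n<m
... | no  n≮m = inj₂ (n ∸ m , sym (m+[n∸m]≡n (≮⇒≥ n≮m)))

colour-bounds : ∀ n → 1 ≤ colour n × colour n ≤ 7
colour-bounds n with below-or-offset 23 n
... | inj₁ n<23 = from-yes (allUpTo? (λ n → 1 ≤? colour n ×-dec colour n ≤? 7) 23) n<23
... | inj₂ (i , refl) = proj₁ (period-bounds i) , ≤-trans (proj₂ (period-bounds i)) (m≤m+n 3 4)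

-- Distances of at least 8 exceed every colour. Shorter ones starting in the initial word form a
-- finite check, and the others lie entirely in the periodic tail.
colour-packing : ∀ n d → colour n ≡ colour (suc d + n) → colour n < suc d
colour-packing n d eq with below-or-offset 7 d | below-or-offset 23 n
... | inj₂ (i , refl) | _ = s≤s (≤-trans (proj₂ (colour-bounds n)) (m≤m+n 7 i))
... | inj₁ d<7 | inj₁ n<23 = from-yes
  (allUpTo? (λ d → allUpTo? (λ n → colour n ≟ colour (suc d + n) →-dec colour n <? suc d) 23) 7)
  d<7 n<23 eq
... | inj₁ d<7 | inj₂ (i , refl) =
  period-packing i d (trans eq (cong colour (shift d)))
  where
  shift : ∀ d → suc d + (23 + i) ≡ 23 + (suc d + i)
  shift d = trans (sym (+-assoc (suc d) 23 i))
    (trans (cong (_+ i) (+-comm (suc d) 23)) (+-assoc 23 (suc d) i))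

∣n-[m+n]∣≡m : ∀ m n → ∣ n - m + n ∣ ≡ m
∣n-[m+n]∣≡m m n = trans (m≤n⇒∣m-n∣≡n∸m (m≤n+m n m)) (m+n∸n≡m m n)

-- Before position 25 a witness may lie to the right, but a finite check finds it among the first 29
-- positions. From 25 on, colours are at most 3 and looking back two places stays in the tail, which
-- supplies 1 and 2. Either way truncation to length at least 29 keeps the witness.
colour-grundy : ∀ n j → 1 ≤ j → j < colour n →
  ∃[ q ] (q < 29 ⊎ q < n) × colour q ≡ j × ∣ q - n ∣ ≤ j
colour-grundy n j 1≤j j<c with below-or-offset 25 n
colour-grundy n j 1≤j j<c | inj₁ n<25 =
  let q , q<29 , near = from-yes
        (allUpTo? (λ j → allUpTo? (λ n → 1 ≤? j →-dec j <? colour n →-dec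
          anyUpTo? (λ q → colour q ≟ j ×-dec ∣ q - n ∣ ≤? j) 29) 25) 7)
        (<-≤-trans j<c (proj₂ (colour-bounds n))) n<25 1≤j j<c
  in q , inj₁ q<29 , near
colour-grundy _ 1 _ 1<c | inj₂ (m , refl) =
  24 + m , inj₂ (n<1+n _) , period-preceded-by-1 (1 + m) 1<c , ≤-reflexive (∣n-[m+n]∣≡m 1 m)
colour-grundy _ 2 _ 2<c | inj₂ (m , refl) =
  23 + m , inj₂ (m<n+m (23 + m) {2} z<s) , period-preceded-by-2 m 2<c , ≤-reflexive (∣n-[m+n]∣≡m 2 m)
colour-grundy _ (suc (suc (suc j))) _ 3+j<c | inj₂ (m , refl) =
  contradiction (≤-trans 3+j<c (proj₂ (period-bounds (2 + m)))) λ { (s≤s (s≤s (s≤s ()))) }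

colouring-is-grundyPacking : ∀ {k} → 29 ≤ k → GrundyPacking k 7 (colour ∘ toℕ)
colouring-is-grundyPacking {k} 29≤k =
  ((λ v → colour-bounds (toℕ v)) , uses) , packing , grundy
  where
  vertex : ∀ {n} → n < k → ∃[ v ] toℕ {k} v ≡ n
  vertex n<k = fromℕ< n<k , toℕ-fromℕ< n<k

  uses : ∀ i → 1 ≤ i → i ≤ 7 → ∃[ v ] colour (toℕ {k} v) ≡ i
  uses i 1≤i i≤7 =
    -- The last colour to make its first appearance is 6, at position 15.
    let n , n<16 , eq = from-yes
          (allUpTo? (λ i → 1 ≤? i →-dec anyUpTo? (λ n → colour n ≟ i) 16) 8) (s≤s i≤7) 1≤i
        v , v≡n = vertex (<-≤-trans n<16 (≤-trans (m≤m+n 16 13) 29≤k))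
    in v , trans (cong colour v≡n) eq

  packing< : ∀ {m n} → m < n → colour m ≡ colour n → colour m < ∣ m - n ∣
  packing< {m} {n} m<n eq =
    subst (colour m <_) (sym dist) (colour-packing m d (trans eq (cong colour n≡)))
    where
    d = n ∸ suc m
    n≡ : n ≡ suc d + m
    n≡ = sym (trans (sym (+-suc d m)) (m∸n+n≡m m<n))
    dist : ∣ m - n ∣ ≡ suc d
    dist = trans (cong (∣ m -_∣) n≡) (∣n-[m+n]∣≡m (suc d) m)

  packing : IsPacking (colour ∘ toℕ {k})
  packing u v u≢v eq with <-cmp (toℕ u) (toℕ v)
  ... | tri< u<v _ _ = packing< u<v eq
  ... | tri≈ _ u≡v _ = contradiction (toℕ-injective u≡v) u≢v
  ... | tri> _ _ v<u = subst₂ _<_ (sym eq) (∣-∣-comm (toℕ v) (toℕ u)) (packing< v<u (sym eq))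

  grundy : IsGrundy (colour ∘ toℕ {k})
  grundy v j 1≤j j<c =
    let q , q< , eq , near = colour-grundy (toℕ v) j 1≤j j<c
        u , u≡q = vertex ([ (λ q<29 → <-≤-trans q<29 29≤k) , (λ q<v → <-trans q<v (toℕ<n v)) ]′ q<)
    in u , trans (cong colour u≡q) eq , subst (λ q → ∣ q - toℕ v ∣ ≤ j) (sym u≡q) near

-- The finite search over words

occursWithin : ℕ → ℕ → List ℕ → Bool
occursWithin zero    c w       = false
occursWithin (suc n) c []      = false
occursWithin (suc n) c (x ∷ w) = (x ≡ᵇ c) ∨ occursWithin n c w

entry : List ℕ → ℕ → ℕ
entry []      _       = 0
entry (x ∷ _) zero    = x
entry (_ ∷ w) (suc i) = entry w i

-- Only the constraints involving the first letter are tested: every window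
-- [i - j, i + j] is complete as soon as its second endpoint is added, and that
-- endpoint is the first letter of the word or of its reversal.
clash : List ℕ → Bool
clash []      = false
clash (c ∷ w) = (0 <ᵇ c) ∧ (c <ᵇ 8) ∧ occursWithin c c w

-- Position `j` is the centre of the initial window of radius `j`; the length test ensures that this
-- window is fully known.
starved : List ℕ → ℕ → Bool
starved w j = (j <ᵇ entry w j) ∧ (j + j <ᵇ length w) ∧ not (occursWithin (suc (j + j)) j w)

bad : List ℕ → Bool
bad w = clash w ∨ any (starved w) (applyUpTo suc 7)

-- Reversing after each step makes the search extend both ends alternately.
refute : ℕ → List ℕ → Bool
refute zero    w = false
refute (suc s) w = all (λ c → bad (c ∷ w) ∨ refute s (reverse (c ∷ w))) (upTo 9)

-- Locally Grundy functions on the integers and their symmetries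

-- Colours above 8 are identified with 8 and the value 0 marks integers off the
-- path, so packing is only required for the values 1, …, 7.
record LocallyGrundy (h : ℤ → ℕ) : Set where
  field
    bounded : ∀ z → h z ≤ 8
    packing : ∀ y z → y ≢ z → h y ≡ h z → 1 ≤ h y → h y < 8 → h y < ℤ.∣ y ℤ.- z ∣
    grundy  : ∀ z j → 1 ≤ j → j < h z → ∃[ y ] h y ≡ j × ℤ.∣ y ℤ.- z ∣ ≤ j

open LocallyGrundy

-- The conditions see only distances. Packing needs `φ` injective, which follows from the isometry;
-- Grundy witnesses are pulled back along the right inverse `ψ`.
reindex : ∀ {h} (φ ψ : ℤ → ℤ) → (∀ z → φ (ψ z) ≡ z) →
  (∀ y z → ℤ.∣ φ y ℤ.- φ z ∣ ≡ ℤ.∣ y ℤ.- z ∣) →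
  LocallyGrundy h → LocallyGrundy (h ∘ φ)
reindex {h} φ ψ φψ isometry g = record
  { bounded = bounded g ∘ φ
  ; packing = λ y z y≢z eq 1≤ <8 → subst (h (φ y) <_) (isometry y z)
      (packing g (φ y) (φ z) (y≢z ∘ φ-injective y z) eq 1≤ <8)
  ; grundy  = λ z j 1≤j j<h →
      let y , eq , near = grundy g (φ z) j 1≤j j<h
      in ψ y , trans (cong h (φψ y)) eq ,
         subst (_≤ j) (trans (cong (λ x → ℤ.∣ x ℤ.- φ z ∣) (sym (φψ y))) (isometry (ψ y) z)) near
  }
  where
  φ-injective : ∀ y z → φ y ≡ φ z → y ≡ z
  φ-injective y z eq = ℤ.i-j≡0⇒i≡j y z (ℤ.∣i∣≡0⇒i≡0
    (trans (sym (isometry y z)) (cong ℤ.∣_∣ (ℤ.i≡j⇒i-j≡0 eq))))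

translate : ∀ {h} a → LocallyGrundy h → LocallyGrundy (λ z → h (a ℤ.+ z))
translate a = reindex (λ z → a ℤ.+ z) (λ z → z ℤ.- a) (cancel a) λ y z → cong ℤ.∣_∣ (difference a y z)
  where
  cancel : ∀ a z → a ℤ.+ (z ℤ.- a) ≡ z
  cancel = solve-∀
  difference : ∀ a y z → (a ℤ.+ y) ℤ.- (a ℤ.+ z) ≡ y ℤ.- z
  difference = solve-∀

reflect : ∀ {h} a → LocallyGrundy h → LocallyGrundy (λ z → h (a ℤ.- z))
reflect a = reindex (λ z → a ℤ.- z) (λ z → a ℤ.- z) (cancel a)
  λ y z → trans (cong ℤ.∣_∣ (difference a y z)) (ℤ.∣i-j∣≡∣j-i∣ z y)
  where
  cancel : ∀ a z → a ℤ.- (a ℤ.- z) ≡ z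
  cancel = solve-∀
  difference : ∀ a y z → (a ℤ.- y) ℤ.- (a ℤ.- z) ≡ z ℤ.- y
  difference = solve-∀

-- Words read off the integers and soundness of the search

prefix : (ℤ → ℕ) → ℕ → List ℕ
prefix h = applyUpTo (h ∘ +_)

applyUpTo-cong : ∀ {A : Set} {f g : ℕ → A} → (∀ i → f i ≡ g i) → ∀ n → applyUpTo f n ≡ applyUpTo g n
applyUpTo-cong f≗g zero    = refl
applyUpTo-cong f≗g (suc n) = cong₂ _∷_ (f≗g 0) (applyUpTo-cong (f≗g ∘ suc) n)

-- Moving the origin one step left realises the letter added by `refute`.
prefix-extend : ∀ h n → prefix (λ z → h (ℤ.-1ℤ ℤ.+ z)) (suc n) ≡ h ℤ.-1ℤ ∷ prefix h n
prefix-extend h n = cong (h ℤ.-1ℤ ∷_) (applyUpTo-cong (λ _ → refl) n)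

-- Reflection in the midpoint of the interval from 0 to `n - 1` realises the reversal in `refute`.
prefix-reverse : ∀ h n → prefix (λ z → h (ℤ.pred (+ n) ℤ.- z)) n ≡ reverse (prefix h n)
prefix-reverse h n = trans (downFrom n) (sym (reverse-applyUpTo (h ∘ +_) n))
  where
  step : ∀ a z → (ℤ.-1ℤ ℤ.+ (ℤ.1ℤ ℤ.+ a)) ℤ.- (ℤ.1ℤ ℤ.+ z) ≡ (ℤ.-1ℤ ℤ.+ a) ℤ.- z
  step = solve-∀
  first : ∀ a → (ℤ.-1ℤ ℤ.+ (ℤ.1ℤ ℤ.+ a)) ℤ.- ℤ.0ℤ ≡ a
  first = solve-∀
  downFrom : ∀ n → prefix (λ z → h (ℤ.pred (+ n) ℤ.- z)) n ≡ applyDownFrom (h ∘ +_) n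
  downFrom zero    = refl
  downFrom (suc n) = cong₂ _∷_ (cong h (first (+ n)))
    (trans (applyUpTo-cong (λ i → cong h (step (+ n) (+ i))) n) (downFrom n))

occursWithin-sound : ∀ n c f m → T (occursWithin n c (applyUpTo f m)) → ∃[ i ] i < n × f i ≡ c
occursWithin-sound (suc n) c f (suc m) p with to (T-∨ {f 0 ≡ᵇ c}) p
... | inj₁ q = 0 , z<s , ≡ᵇ⇒≡ _ _ q
... | inj₂ q = let i , i<n , eq = occursWithin-sound n c (f ∘ suc) m q in suc i , s<s i<n , eq

occursWithin-complete : ∀ n f m i → i < n → i < m → T (occursWithin n (f i) (applyUpTo f m))
occursWithin-complete (suc n) f (suc m) zero    _         _         =
  from (T-∨ {f 0 ≡ᵇ f 0}) (inj₁ (≡⇒≡ᵇ (f 0) (f 0) refl))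
occursWithin-complete (suc n) f (suc m) (suc i) (s<s i<n) (s<s i<m) =
  from (T-∨ {f 0 ≡ᵇ f (suc i)}) (inj₂ (occursWithin-complete n (f ∘ suc) m i i<n i<m))

entry-applyUpTo : ∀ f {m i} → i < m → entry (applyUpTo f m) i ≡ f i
entry-applyUpTo f {suc m} {zero}  _         = refl
entry-applyUpTo f {suc m} {suc i} (s<s i<m) = entry-applyUpTo (f ∘ suc) i<m

∣+m-+n∣≡∣m-n∣ : ∀ m n → ℤ.∣ + m ℤ.- + n ∣ ≡ ∣ m - n ∣
∣+m-+n∣≡∣m-n∣ m n = trans (cong ℤ.∣_∣ (ℤ.m-n≡m⊖n m n)) (go m n)
  where
  go : ∀ m n → ℤ.∣ m ℤ.⊖ n ∣ ≡ ∣ m - n ∣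
  go zero    zero    = refl
  go zero    (suc n) = refl
  go (suc m) zero    = refl
  go (suc m) (suc n) = trans (cong ℤ.∣_∣ (ℤ.[1+m]⊖[1+n]≡m⊖n m n)) (go m n)

∣z-j∣≤j⇒z∈[0,2j] : ∀ z j → ℤ.∣ z ℤ.- + j ∣ ≤ j → ∃[ i ] z ≡ + i × i ≤ j + j
∣z-j∣≤j⇒z∈[0,2j] (+ i) j near = i , refl ,
  ≤-trans (m≤n+∣m-n∣ i j) (+-monoʳ-≤ j (subst (_≤ j) (∣+m-+n∣≡∣m-n∣ i j) near))
∣z-j∣≤j⇒z∈[0,2j] -[1+ a ] (suc j) (s≤s far) =
  contradiction far (<⇒≱ (s≤s (m≤n+m j a)))

clash-sound : ∀ {h} → LocallyGrundy h → ∀ n → ¬ T (clash (prefix h n))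
clash-sound {h} g (suc n) p =
  let 0<c , q    = to (T-∧ {0 <ᵇ h (+ 0)}) p
      c<8 , r    = to (T-∧ {h (+ 0) <ᵇ 8}) q
      i , i<c , eq = occursWithin-sound (h (+ 0)) (h (+ 0)) (h ∘ +_ ∘ suc) n r
  in ≤⇒≯ i<c (packing g (+ 0) (+ suc i) (λ ()) (sym eq) (<ᵇ⇒< 0 _ 0<c) (<ᵇ⇒< _ 8 c<8))

-- The Grundy witness of colour `j` for the integer `j` lies between 0 and `2j`, hence inside the
-- known word.
starved-sound : ∀ {h} → LocallyGrundy h → ∀ n j → 1 ≤ j → ¬ T (starved (prefix h n) j)
starved-sound {h} g n j 1≤j p =
  let j<entry , q   = to (T-∧ {j <ᵇ entry w j}) p
      2j<length , r = to (T-∧ {j + j <ᵇ length w}) q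
      2j<n = subst (j + j <_) (length-applyUpTo (h ∘ +_) n) (<ᵇ⇒< (j + j) _ 2j<length)
      j<h  = subst (j <_) (entry-applyUpTo (h ∘ +_) (≤-<-trans (m≤m+n j j) 2j<n)) (<ᵇ⇒< j _ j<entry)
      y , eq , near = grundy g (+ j) j 1≤j j<h
      i , y≡i , i≤2j = ∣z-j∣≤j⇒z∈[0,2j] y j near
  in subst T (to T-not-≡ r)
       (subst (λ c → T (occursWithin (suc (j + j)) c w)) (trans (cong h (sym y≡i)) eq)
         (occursWithin-complete (suc (j + j)) (h ∘ +_) n i (s≤s i≤2j) (≤-<-trans i≤2j 2j<n)))
  where w = prefix h n

bad-sound : ∀ {h} → LocallyGrundy h → ∀ n → ¬ T (bad (prefix h n))
bad-sound {h} g n p with to (T-∨ {clash (prefix h n)}) p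
... | inj₁ q = clash-sound g n q
... | inj₂ q with find (any⁻ (starved (prefix h n)) (applyUpTo suc 7) q)
...   | j , j∈ , r with ∈-applyUpTo⁻ suc j∈
...     | i , _ , refl = starved-sound g n (suc i) z<s r

-- Induction on the depth: each step of the search is matched by a translation and a reflection of
-- `h`, so the word is always a prefix of some locally Grundy function.
refute-sound : ∀ s {h} → LocallyGrundy h → ∀ n → ¬ T (refute s (prefix h n))
refute-sound (suc s) {h} g n p =
  [ (λ q → bad-sound g′ (suc n) (subst (T ∘ bad) (sym (prefix-extend h n)) q))
  , (λ q → refute-sound s (reflect (+ n) g′) (suc n) (subst (T ∘ refute s) (sym reversed) q))
  ]′ (to (T-∨ {bad (c ∷ w)})
       -- Of the nine branches only that of the actual letter `h ℤ.-1ℤ` is used; it is among them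
       -- because `h` is bounded by 8.
       (All.lookup (all⁺ (λ x → bad (x ∷ w) ∨ refute s (reverse (x ∷ w))) (upTo 9) p)
         (∈-upTo⁺ (s≤s (bounded g ℤ.-1ℤ)))))
  where
  w = prefix h n
  c = h ℤ.-1ℤ
  h′ : ℤ → ℕ
  h′ z = h (ℤ.-1ℤ ℤ.+ z)
  g′ : LocallyGrundy h′
  g′ = translate ℤ.-1ℤ g
  reversed : prefix (λ z → h′ (+ n ℤ.- z)) (suc n) ≡ reverse (c ∷ w)
  reversed = trans (prefix-reverse h′ (suc n)) (cong reverse (prefix-extend h n))

-- From the path to the integers, and the upper bound

module _ {k : ℕ} (c : Fin k → ℕ) where

  extension : ℤ → ℕ
  extension (+ n) with n <? k
  ... | yes n<k = c (fromℕ< n<k) ⊓ 8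
  ... | no  _   = 0
  extension -[1+ _ ] = 0

  extension-toℕ : ∀ v → extension (+ toℕ v) ≡ c v ⊓ 8
  extension-toℕ v with toℕ v <? k
  ... | yes v<k = cong (λ u → c u ⊓ 8) (fromℕ<-toℕ v v<k)
  ... | no  v≮k = contradiction (toℕ<n v) v≮k

  extension-support : ∀ z → 1 ≤ extension z → ∃[ v ] z ≡ + toℕ {k} v
  extension-support (+ n) 1≤ with n <? k
  ... | yes n<k = fromℕ< n<k , cong +_ (sym (toℕ-fromℕ< n<k))
  extension-support (+ n) () | no _
  extension-support -[1+ _ ] ()

  extension-bounded : ∀ z → extension z ≤ 8
  extension-bounded (+ n) with n <? k
  ... | yes n<k = m⊓n≤n _ 8
  ... | no  _   = z≤n
  extension-bounded -[1+ _ ] = z≤n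

  extension<8⇒≡ : ∀ v → extension (+ toℕ v) < 8 → extension (+ toℕ v) ≡ c v
  extension<8⇒≡ v e<8 with ≤-total (c v) 8
  ... | inj₁ c≤8 = trans (extension-toℕ v) (m≤n⇒m⊓n≡m c≤8)
  ... | inj₂ 8≤c = contradiction
    (subst (_< 8) (trans (extension-toℕ v) (m≥n⇒m⊓n≡n 8≤c)) e<8) (<-irrefl refl)

  -- Positive values occur only on the path, and values below 8 are true colours, so packing
  -- transfers. A demanded colour `j` is below 8, so the cap fixes the colour of its witness.
  extension-locallyGrundy : IsPacking c → IsGrundy c → LocallyGrundy extension
  extension-locallyGrundy isPacking isGrundy = record
    { bounded = extension-bounded ; packing = packing′ ; grundy = grundy′ }
    where
    packing′ : ∀ y z → y ≢ z → extension y ≡ extension z → 1 ≤ extension y → extension y < 8 →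
           extension y < ℤ.∣ y ℤ.- z ∣
    packing′ y z y≢z eq 1≤ <8 with extension-support y 1≤ | extension-support z (subst (1 ≤_) eq 1≤)
    ... | u , refl | v , refl = subst₂ _<_ (sym eu) (sym (∣+m-+n∣≡∣m-n∣ (toℕ u) (toℕ v)))
        (isPacking u v (y≢z ∘ cong (+_ ∘ toℕ))
          (trans (sym eu) (trans eq (extension<8⇒≡ v (subst (_< 8) eq <8)))))
      where eu = extension<8⇒≡ u <8

    grundy′ : ∀ z j → 1 ≤ j → j < extension z → ∃[ y ] extension y ≡ j × ℤ.∣ y ℤ.- z ∣ ≤ j
    grundy′ z j 1≤j j<e with extension-support z (≤-trans 1≤j (<⇒≤ j<e))
    ... | v , refl =
      let j<c⊓8 = subst (j <_) (extension-toℕ v) j<e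
          u , cu≡j , near = isGrundy v j 1≤j (<-≤-trans j<c⊓8 (m⊓n≤m _ 8))
          j≤8 = <⇒≤ (<-≤-trans j<c⊓8 (m⊓n≤n (c v) 8))
      in + toℕ u
       , trans (extension-toℕ u) (trans (cong (_⊓ 8) cu≡j) (m≤n⇒m⊓n≡m j≤8))
       , subst (_≤ j) (sym (∣+m-+n∣≡∣m-n∣ (toℕ u) (toℕ v))) near

-- With `s` abstract the search does not unfold here; it is evaluated only where a concrete depth is
-- supplied.
refuted⇒no-colour-8 : ∀ s → T (refute s (8 ∷ [])) →
  ∀ {k} {c : Fin k → ℕ} → IsPacking c → IsGrundy c → ∀ v → c v ≢ 8
refuted⇒no-colour-8 s refuted {c = c} isPacking isGrundy v cv≡8 =
  refute-sound s (translate (+ toℕ v) (extension-locallyGrundy c isPacking isGrundy)) 1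
    (subst (λ x → T (refute s (x ∷ []))) (sym centre) refuted)
  where
  centre : extension c (+ toℕ v ℤ.+ + 0) ≡ 8
  centre = trans (cong (extension c) (ℤ.+-identityʳ (+ toℕ v)))
    (trans (extension-toℕ c v) (cong (_⊓ 8) cv≡8))

no-colour-8 : ∀ {k} {c : Fin k → ℕ} → IsPacking c → IsGrundy c → ∀ v → c v ≢ 8
-- Eighteen letters, nine on each side of the 8, complete the window of 19. That `tt` type-checks is
-- the result of the search.
no-colour-8 = refuted⇒no-colour-8 18 tt

grundyPacking-colours≤7 : ∀ {k} m (c : Fin k → ℕ) → GrundyPacking k m c → m ≤ 7
grundyPacking-colours≤7 m c ((_ , uses) , isPacking , isGrundy) with m ≤? 7
... | yes m≤7 = m≤7
... | no  m≰7 =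
  let v , cv≡8 = uses 8 (s≤s z≤n) (≰⇒> m≰7)
  in contradiction cv≡8 (no-colour-8 isPacking isGrundy v)

theorem22 : (k : ℕ) → 29 ≤ k → GrundyPackingNumberIs k 7
theorem22 k 29≤k = (colour ∘ toℕ , colouring-is-grundyPacking 29≤k) , grundyPacking-colours≤7
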